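{- If $G$ is a $2$-connected triangle-free graph with $\delta(G)\geq 3$, then $G$ contains an edge $e=xy$ such that $\kappa(G-\{x,y\})\geq 2$.
   Context: All graphs are finite, undirected and simple. $\delta(G)$ is the minimum degree of $G$. For $U\subseteq V(G)$, $G-U$ is the subgraph induced by $V(G)\setminus U$. The connectivity $\kappa(G)$ is the minimum cardinality of a set $S\subseteq V(G)$ such that $G-S$ is disconnected or trivial (a single vertex); $G$ is $k$-connected if $\kappa(G)\geq k$. -}

module Defs where

open import Data.Fin.Base using (Fin)
open import Data.Fin.Subset using (Subset; _∈_; _⊆_; _─_; ∣_∣)
open import Data.Fin.Subset.Properties using (_∈?_)
open import Data.Nat.Base using (ℕ; _≤_; _≥_)
open import Data.Product.Base using (∃; ∃-syntax; _×_; _,_; proj₁; proj₂)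
open import Data.Sum.Base using (_⊎_)
open import Data.Vec.Base using (tabulate)
open import Level using (0ℓ)
open import Relation.Binary.Construct.Closure.ReflexiveTransitive using (Star)
open import Relation.Binary.Core using (Rel)
open import Relation.Binary.Definitions using (Decidable; Symmetric)
open import Relation.Binary.PropositionalEquality.Core using (_≡_)
open import Relation.Nullary.Decidable.Core using (does; _×-dec_)
open import Relation.Nullary.Negation.Core using (¬_)

-- The vertex set V is an arbitrary subset of the label set Fin n, so that
-- deleting vertices keeps the labels of the remaining ones.
-- Adjacency is decidable, as it is classically for every finite graph.
record Graph (n : ℕ) : Set₁ where
  infix 4 _~_ _~?_
  field
    V        : Subset n
    _~_      : Rel (Fin n) 0ℓ
    _~?_     : Decidable _~_
    ~-sym    : Symmetric _~_
    ~-irrefl : ∀ {u} → ¬ (u ~ u)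
    ~⇒∈V     : ∀ {u v} → u ~ v → u ∈ V

private
  variable
    n : ℕ

infixl 6 _-_

_-_ : Graph n → Subset n → Graph n
G - U = record
  { V        = W
  ; _~_      = λ u v → (u ∈ W × v ∈ W) × u ~ v
  ; _~?_     = λ u v → ((u ∈? W) ×-dec (v ∈? W)) ×-dec (u ~? v)
  ; ~-sym    = λ { ((u∈W , v∈W) , u~v) → (v∈W , u∈W) , ~-sym u~v }
  ; ~-irrefl = λ p → ~-irrefl (proj₂ p)
  ; ~⇒∈V     = λ p → proj₁ (proj₁ p)
  }
  where
  open Graph G
  W = V ─ U

module _ (G : Graph n) where
  open Graph G

  TriangleFree : Set
  TriangleFree = ∀ x y z → ¬ (x ~ y × y ~ z × z ~ x)

  neighbours : Fin n → Subset n
  neighbours u = tabulate (λ v → does (u ~? v))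

  degree : Fin n → ℕ
  degree u = ∣ neighbours u ∣

  Connected : Set
  Connected = ∀ {u v} → u ∈ V → v ∈ V → Star _~_ u v

  Disconnected : Set
  Disconnected = ¬ Connected

  Trivial : Set
  Trivial = ∣ V ∣ ≡ 1

IsMinimum : (ℕ → Set) → ℕ → Set
IsMinimum P m = P m × (∀ k → P k → m ≤ k)

-- The minima δ and κ are given by their graphs "δ(G) = d" and "κ(G) = k".
-- Neither has a value when V is empty, so δ[ G ]≥ d and κ[ G ]≥ k below,
-- which assert that the minimum exists, exclude the empty graph.

IsMinDegree : Graph n → ℕ → Set
IsMinDegree G = IsMinimum (λ d → ∃[ v ] (v ∈ Graph.V G × degree G v ≡ d))

IsConnectivity : Graph n → ℕ → Set
IsConnectivity G = IsMinimum λ k →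
  ∃[ S ] (S ⊆ Graph.V G × (Disconnected (G - S) ⊎ Trivial (G - S)) × ∣ S ∣ ≡ k)

δ[_]≥_ : Graph n → ℕ → Set
δ[ G ]≥ d = ∃[ m ] (IsMinDegree G m × m ≥ d)

κ[_]≥_ : Graph n → ℕ → Set
κ[ G ]≥ k = ∃[ m ] (IsConnectivity G m × m ≥ k)

_-Connected_ : ℕ → Graph n → Set
k -Connected G = κ[ G ]≥ k

{-# OPTIONS --safe #-}

-- Call a vertex set H robust if deleting any one vertex leaves it connected.
-- Starting from the two ends of an edge, a robust H is grown until its
-- complement R is just an edge, which is then the one sought.  Suppose that R
-- contains an edge xy and a further vertex r.  If some v ∈ R has two neighbours
-- in H and R ∖ {v} contains an edge, pass to H ∪ {v}.  Otherwise no v ∈ R has two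
-- neighbours in H: every edge in R would meet v, so, as δ ≥ 3, for r ≠ v the
-- vertex r would have two neighbours in H as well, and xy would have to meet r.
-- As G is 2-connected there is a path through R joining distinct vertices of H.
-- Let a, v, u, … , b be a shortest one, with interior P; then H ∪ P is robust.
-- If R ∖ P had no edge, then v would have a neighbour z ∈ R ∖ P, whose other
-- neighbours lie in H ∪ P, at most one of them in H; none of them is u since G
-- is triangle-free, so going through z gives a shorter path.
module Submission where

open import Data.Bool.Base using (true; false)
open import Data.Empty using (⊥)
open import Data.Fin.Base using (Fin)
open import Data.Fin.Properties using (_≟_; any?; all?)
open import Data.Fin.Subset using (Subset; _∈_; _∉_; _⊆_; _⊂_; _⊃_; _─_; _∪_; ⁅_⁆; ∣_∣)
open import Data.Fin.Subset.Induction using (Acc; acc; ⊃-wellFounded)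
open import Data.Fin.Subset.Properties
open import Data.Nat.Base using (ℕ; zero; suc; _+_; _≤_; _<_; z≤n; s≤s)
open import Data.Nat.Induction using (<-wellFounded)
open import Data.Nat.Properties as ℕ using (anyUpTo?; ≤-trans; ≤-reflexive; ≤-refl; m≤n⇒m≤1+n; ≮⇒≥; <⇒≱)
open import Data.Product.Base using (∃; ∃-syntax; _×_; _,_; proj₁; proj₂)
open import Data.Sum.Base using (_⊎_; inj₁; inj₂; [_,_]′)
open import Data.Vec.Base using ([]; _∷_; here; there)
open import Data.Vec.Properties using ([]=⇒lookup; lookup∘tabulate)
open import Function.Base using (_∘_)
open import Level using (0ℓ)
open import Relation.Binary.Construct.Closure.ReflexiveTransitive as Star using (Star; ε; _◅_; _◅◅_)
open import Relation.Binary.Core using (Rel)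
open import Relation.Binary.Definitions using (Decidable)
open import Relation.Binary.PropositionalEquality using (_≡_; _≢_; refl; sym; trans; cong₂; subst; ≢-sym)
open import Relation.Nullary using (¬_; Dec; yes; no; contradiction; ¬?)
open import Relation.Nullary.Decidable using (does; map′; _×-dec_; _⊎-dec_; _→-dec_; decidable-stable)
open import Defs

private
  variable
    n : ℕ
    p q : Subset n
    u v x y : Fin n

-- Finite subsets: differences and cardinalities.

x∈p─q⇒x∈p : x ∈ p ─ q → x ∈ p
x∈p─q⇒x∈p {p = p} {q = q} = p─q⊆p p q

x∈p─q⇒x∉q : x ∈ p ─ q → x ∉ q
x∈p─q⇒x∉q {p = _ ∷ _} {q = true ∷ _}  () here
x∈p─q⇒x∉q {p = _ ∷ _} {q = _ ∷ _} (there x∈p─q) (there x∈q) = x∈p─q⇒x∉q x∈p─q x∈q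

∣p∪q∣≤∣p∣+∣q∣ : (p q : Subset n) → ∣ p ∪ q ∣ ≤ ∣ p ∣ + ∣ q ∣
∣p∪q∣≤∣p∣+∣q∣ []          []          = z≤n
∣p∪q∣≤∣p∣+∣q∣ (false ∷ p) (false ∷ q) = ∣p∪q∣≤∣p∣+∣q∣ p q
∣p∪q∣≤∣p∣+∣q∣ (false ∷ p) (true ∷ q)  =
  ≤-trans (s≤s (∣p∪q∣≤∣p∣+∣q∣ p q)) (≤-reflexive (sym (ℕ.+-suc ∣ p ∣ ∣ q ∣)))
∣p∪q∣≤∣p∣+∣q∣ (true ∷ p)  (false ∷ q) = s≤s (∣p∪q∣≤∣p∣+∣q∣ p q)
∣p∪q∣≤∣p∣+∣q∣ (true ∷ p)  (true ∷ q)  =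
  s≤s (≤-trans (∣p∪q∣≤∣p∣+∣q∣ p q) (ℕ.+-monoʳ-≤ ∣ p ∣ (ℕ.n≤1+n ∣ q ∣)))

x∈p⇒1≤∣p∣ : x ∈ p → 1 ≤ ∣ p ∣
x∈p⇒1≤∣p∣ x∈p = ≤-trans (s≤s z≤n) (x∈p⇒∣p-x∣<∣p∣ x∈p)

x≢y⇒2≤∣p∣ : x ∈ p → y ∈ p → x ≢ y → 2 ≤ ∣ p ∣
x≢y⇒2≤∣p∣ x∈p y∈p x≢y =
  ≤-trans (s≤s (x∈p⇒1≤∣p∣ (x∈p∧x≢y⇒x∈p-y x∈p x≢y))) (x∈p⇒∣p-x∣<∣p∣ y∈p)

∣p∣≥3⇒∃≢ : 3 ≤ ∣ p ∣ → ∀ x y → ∃[ z ] (z ∈ p × z ≢ x × z ≢ y)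
∣p∣≥3⇒∃≢ {p = p} 3≤∣p∣ x y
  with any? (λ z → z ∈? p ×-dec (¬? (z ≟ x) ×-dec ¬? (z ≟ y)))
... | yes found = found
... | no  none  = contradiction 3≤∣p∣ (<⇒≱ (s≤s ∣p∣≤2))
  where
  p⊆⁅x⁆∪⁅y⁆ : p ⊆ ⁅ x ⁆ ∪ ⁅ y ⁆
  p⊆⁅x⁆∪⁅y⁆ {z} z∈p with z ≟ x | z ≟ y
  ... | yes refl | _        = x∈p∪q⁺ (inj₁ (x∈⁅x⁆ x))
  ... | no _     | yes refl = x∈p∪q⁺ (inj₂ (x∈⁅x⁆ y))
  ... | no z≢x   | no z≢y   = contradiction (z , z∈p , z≢x , z≢y) none

  ∣p∣≤2 : ∣ p ∣ ≤ 2
  ∣p∣≤2 = ≤-trans (p⊆q⇒∣p∣≤∣q∣ p⊆⁅x⁆∪⁅y⁆)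
    (≤-trans (∣p∪q∣≤∣p∣+∣q∣ ⁅ x ⁆ ⁅ y ⁆)
      (≤-reflexive (cong₂ _+_ (∣⁅x⁆∣≡1 x) (∣⁅x⁆∣≡1 y))))

-- Least witnesses and decidable reachability.

leastWitness : {P : ℕ → Set} → (∀ k → Dec (P k)) → ∀ {k} → P k → ∃ (IsMinimum P)
leastWitness {P} P? = go (<-wellFounded _)
  where
  go : ∀ {k} → Acc _<_ k → P k → ∃ (IsMinimum P)
  go {k} (acc rs) pk with anyUpTo? P? k
  ... | yes (_ , j<k , pj) = go (rs j<k) pj
  ... | no  none           = k , pk , λ j pj → ≮⇒≥ λ j<k → none (j , j<k , pj)

module _ {T : Rel (Fin n) 0ℓ} (T? : Decidable T) where

  -- `grow` enlarges the set of vertices reached from `u` until no `T`-step leaves it; a closed set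
  -- without `v` refutes `Star T u v`.
  star? : Decidable (Star T)
  star? u v = grow ⁅ u ⁆ (x∈⁅x⁆ u) (λ s∈ → subst (Star T u) (sym (x∈⁅y⁆⇒x≡y u s∈)) ε) (⊃-wellFounded _)
    where
    grow : ∀ S → u ∈ S → (∀ {s} → s ∈ S → Star T u s) → Acc _⊃_ S → Dec (Star T u v)
    grow S u∈S reached (acc rs)
      with any? (λ s → any? (λ t → s ∈? S ×-dec (¬? (t ∈? S) ×-dec T? s t)))
    ... | yes (s , t , s∈S , t∉S , st) =
      grow (S ∪ ⁅ t ⁆) (p⊆p∪q _ u∈S) reached′
        (rs (p⊆p∪q _ , t , q⊆p∪q S _ (x∈⁅x⁆ t) , t∉S))
      where
      reached′ : ∀ {r} → r ∈ S ∪ ⁅ t ⁆ → Star T u r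
      reached′ r∈ with x∈p∪q⁻ S _ r∈
      ... | inj₁ r∈S = reached r∈S
      ... | inj₂ r∈t with refl ← x∈⁅y⁆⇒x≡y t r∈t = reached s∈S ◅◅ (st ◅ ε)
    ... | no closed with v ∈? S
    ...   | yes v∈S = yes (reached v∈S)
    ...   | no  v∉S = no λ uv → v∉S (stays u∈S uv)
      where
      stays : ∀ {s t} → s ∈ S → Star T s t → t ∈ S
      stays s∈S ε = s∈S
      stays {s} s∈S (_◅_ {j = r} sr rt) = stays
        (decidable-stable (r ∈? S) λ r∉S → closed (s , r , s∈S , r∉S , sr)) rt

connected? : (G : Graph n) → Dec (Connected G)
connected? G = map′ (λ c {u} {v} → c u v) (λ c u v → c {u} {v})
  (all? λ u → all? λ v → (u ∈? V) →-dec ((v ∈? V) →-dec star? _~?_ u v))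
  where open Graph G

∈neighbours⇒~ : (G : Graph n) → x ∈ neighbours G u → Graph._~_ G u x
∈neighbours⇒~ {x = x} {u = u} G x∈
  with u ~? x | trans (sym (lookup∘tabulate (λ z → does (u ~? z)) x)) ([]=⇒lookup x∈)
  where open Graph G
... | yes u~x | _ = u~x

-- Connectivity at least 2 in terms of single-vertex deletions.

module _ (G : Graph n) where
  open Graph G

  Avoiding : Subset n → Fin n → Rel (Fin n) 0ℓ
  Avoiding K w u v = u ~ v × (u ∈ K × u ≢ w) × (v ∈ K × v ≢ w)

  ConnectedOff : Subset n → Fin n → Set
  ConnectedOff K w = ∀ {u v} → u ∈ K → v ∈ K → u ≢ w → v ≢ w → Star (Avoiding K w) u v

  -- If removing `w` disconnected `G`, then `⁅ w ⁆` would be a separating set of size 1, below the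
  -- minimum.
  κ≥2⇒connectedOff : κ[ G ]≥ 2 → ∀ {w} → w ∈ V → ConnectedOff V w
  κ≥2⇒connectedOff (m , (_ , least) , 2≤m) {w} w∈V {u} {v} u∈V v∈V u≢w v≢w =
    Star.map (λ { ((a∈ , b∈) , a~b) → a~b , kept a∈ , kept b∈ })
      (connected (x∈p∧x≢y⇒x∈p-y u∈V u≢w) (x∈p∧x≢y⇒x∈p-y v∈V v≢w))
    where
    kept : ∀ {z} → z ∈ V ─ ⁅ w ⁆ → z ∈ V × z ≢ w
    kept z∈ = x∈p─q⇒x∈p z∈ , x∉⁅y⁆⇒x≢y (x∈p─q⇒x∉q z∈)

    connected : Connected (G - ⁅ w ⁆)
    connected = decidable-stable (connected? (G - ⁅ w ⁆)) λ disconnected →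
      <⇒≱ 2≤m (least 1
        (⁅ w ⁆ , (λ z∈ → subst (_∈ V) (sym (x∈⁅y⁆⇒x≡y w z∈)) w∈V) , inj₁ disconnected , ∣⁅x⁆∣≡1 w))

  -- The third vertex makes V nonempty, rules out trivial G - S and reduces
  -- the case S = ∅ to the removal of a vertex other than the two to be joined.
  κ≥2-intro : Fin n → (∀ u v → ∃[ w ] (w ∈ V × w ≢ u × w ≢ v)) →
              (∀ {w} → w ∈ V → ConnectedOff V w) → κ[ G ]≥ 2
  κ≥2-intro o third connectedOff with o′ , o′∈V , _ ← third o o =
    m , isMin , large (proj₁ isMin)
    where
    Separable : ℕ → Set
    Separable k = ∃[ S ] (S ⊆ V × (Disconnected (G - S) ⊎ Trivial (G - S)) × ∣ S ∣ ≡ k)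

    separable? : ∀ k → Dec (Separable k)
    separable? k = anySubset? λ S → S ⊆? V ×-dec
      ((¬? (connected? (G - S)) ⊎-dec (∣ V ─ S ∣ ℕ.≟ 1)) ×-dec (∣ S ∣ ℕ.≟ k))

    -- Deleting all of `V` but `o′` leaves a trivial graph, so the minimum defining `κ` exists.
    V─[V─o′]≡1 : ∣ V ─ (V ─ ⁅ o′ ⁆) ∣ ≡ 1
    V─[V─o′]≡1 = ℕ.≤-antisym
      (≤-trans (p⊆q⇒∣p∣≤∣q∣ only) (≤-reflexive (∣⁅x⁆∣≡1 o′)))
      (x∈p⇒1≤∣p∣ (x∈p∧x∉q⇒x∈p─q o′∈V (λ o′∈ → x∈p─q⇒x∉q o′∈ (x∈⁅x⁆ o′))))
      where
      only : V ─ (V ─ ⁅ o′ ⁆) ⊆ ⁅ o′ ⁆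
      only {z} z∈ = decidable-stable (z ∈? ⁅ o′ ⁆) λ z∉ →
        x∈p─q⇒x∉q z∈ (x∈p∧x∉q⇒x∈p─q (x∈p─q⇒x∈p z∈) z∉)

    min : ∃ (IsMinimum Separable)
    min = leastWitness separable? (V ─ ⁅ o′ ⁆ , p─q⊆p V _ , inj₂ V─[V─o′]≡1 , refl)

    m = proj₁ min
    isMin = proj₂ min

    module _ {S : Subset n} (S⊆V : S ⊆ V) (∣S∣<2 : ∣ S ∣ < 2) where

      unique : u ∈ S → v ∈ S → u ≡ v
      unique {u} {v} u∈S v∈S = decidable-stable (u ≟ v) λ u≢v →
        <⇒≱ ∣S∣<2 (x≢y⇒2≤∣p∣ u∈S v∈S u≢v)

      connected : Connected (G - S)
      connected {u} {v} u∈ v∈ with nonempty? S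
      ... | yes (w , w∈S) =
        Star.map (λ { (a~b , a , b) → (kept a , kept b) , a~b })
          (connectedOff (S⊆V w∈S) (x∈p─q⇒x∈p u∈) (x∈p─q⇒x∈p v∈) (≢w u∈) (≢w v∈))
        where
        ≢w : ∀ {z} → z ∈ V ─ S → z ≢ w
        ≢w z∈ refl = x∈p─q⇒x∉q z∈ w∈S
        kept : ∀ {z} → z ∈ V × z ≢ w → z ∈ V ─ S
        kept (z∈V , z≢w) = x∈p∧x∉q⇒x∈p─q z∈V λ z∈S → z≢w (unique z∈S w∈S)
      ... | no empty with w , w∈V , w≢u , w≢v ← third u v =
        Star.map (λ { (a~b , a , b) → (kept a , kept b) , a~b })
          (connectedOff w∈V (x∈p─q⇒x∈p u∈) (x∈p─q⇒x∈p v∈) (≢-sym w≢u) (≢-sym w≢v))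
        where
        kept : ∀ {z} → z ∈ V × z ≢ w → z ∈ V ─ S
        kept (z∈V , _) = x∈p∧x∉q⇒x∈p─q z∈V λ z∈S → empty (_ , z∈S)

      -- `S` has at most one vertex; `w` is that vertex, or the arbitrary label `o` when `S` is
      -- empty.
      hub : ∃[ w ] (∀ {z} → z ≢ w → z ∉ S)
      hub with nonempty? S
      ... | yes (w , w∈S) = w , λ z≢w z∈S → z≢w (unique z∈S w∈S)
      ... | no empty      = o , λ _ z∈S → empty (_ , z∈S)

      nontrivial : ¬ Trivial (G - S)
      nontrivial ∣V─S∣≡1
        with w , outside ← hub
        with a , a∈V , a≢w , _ ← third w w
        with b , b∈V , b≢w , b≢a ← third w a =
        <⇒≱ (x≢y⇒2≤∣p∣ (x∈p∧x∉q⇒x∈p─q a∈V (outside a≢w))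
                        (x∈p∧x∉q⇒x∈p─q b∈V (outside b≢w)) (≢-sym b≢a))
            (≤-reflexive ∣V─S∣≡1)

    large : ∀ {k} → Separable k → 2 ≤ k
    large (S , S⊆V , separates , refl) = ≮⇒≥ λ ∣S∣<2 →
      [ (λ disconnected → disconnected (connected S⊆V ∣S∣<2)) , nontrivial S⊆V ∣S∣<2 ]′ separates

  -- `x` and `y` are arbitrary labels: passing one vertex twice excludes just that one.
  δ≥3⇒another : δ[ G ]≥ 3 → ∀ {v} → v ∈ V → ∀ x y → ∃[ z ] (v ~ z × z ≢ x × z ≢ y)
  δ≥3⇒another (m , (_ , least) , 3≤m) {v} v∈V x y
    with z , z∈ , z≢x , z≢y ← ∣p∣≥3⇒∃≢ (≤-trans 3≤m (least _ (v , v∈V , refl))) x y =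
    z , ∈neighbours⇒~ G z∈ , z≢x , z≢y

-- Robust vertex sets.

module _ (G : Graph n) where
  open Graph G

  -- For `w` outside `K` the condition says that `K` itself is connected.
  Robust : Subset n → Set
  Robust K = ∀ w → ConnectedOff G K w

  Avoiding-sym : ∀ {K w} → Avoiding G K w u v → Avoiding G K w v u
  Avoiding-sym (u~v , u∈ , v∈) = ~-sym u~v , v∈ , u∈

  EdgeOff : Subset n → Set
  EdgeOff K = ∃[ x ] ∃[ y ] (x ~ y × x ∉ K × y ∉ K)

  edgeOff? : ∀ K → Dec (EdgeOff K)
  edgeOff? K = any? λ x → any? λ y → (x ~? y) ×-dec (¬? (x ∈? K) ×-dec ¬? (y ∈? K))

  Attached : Subset n → Fin n → Set
  Attached H v = ∃[ a ] ∃[ b ] (a ∈ H × b ∈ H × a ≢ b × v ~ a × v ~ b)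

  attached? : ∀ H v → Dec (Attached H v)
  attached? H v = any? λ a → any? λ b →
    a ∈? H ×-dec (b ∈? H ×-dec (¬? (a ≟ b) ×-dec ((v ~? a) ×-dec (v ~? b))))

  -- Both vertices are first moved into `H` off `w`; robustness of `H` then joins the vertices
  -- reached.
  robust-⊆ : ∀ {H K} → H ⊆ K → Robust H →
             (∀ w {u} → u ∈ K → u ≢ w → ∃[ h ] (h ∈ H × h ≢ w × Star (Avoiding G K w) u h)) →
             Robust K
  robust-⊆ H⊆K robust retract w u∈K v∈K u≢w v≢w
    with h , h∈H , h≢w , uh ← retract w u∈K u≢w
    with i , i∈H , i≢w , vi ← retract w v∈K v≢w =
    uh ◅◅ Star.map (λ { (a~b , (a∈H , a≢w) , (b∈H , b≢w)) →
                        a~b , (H⊆K a∈H , a≢w) , (H⊆K b∈H , b≢w) })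
                   (robust w h∈H i∈H h≢w i≢w)
       ◅◅ Star.reverse Avoiding-sym vi

  robust-edge : u ~ v → Robust (⁅ u ⁆ ∪ ⁅ v ⁆)
  robust-edge {u} {v} u~v w {s} {t} s∈ t∈ s≢w t≢w with x∈p∪q⁻ _ _ s∈ | x∈p∪q⁻ _ _ t∈
  ... | inj₁ s∈u | inj₁ t∈u with refl ← x∈⁅y⁆⇒x≡y u s∈u | refl ← x∈⁅y⁆⇒x≡y u t∈u = ε
  ... | inj₂ s∈v | inj₂ t∈v with refl ← x∈⁅y⁆⇒x≡y v s∈v | refl ← x∈⁅y⁆⇒x≡y v t∈v = ε
  ... | inj₁ s∈u | inj₂ t∈v with refl ← x∈⁅y⁆⇒x≡y u s∈u | refl ← x∈⁅y⁆⇒x≡y v t∈v =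
    (u~v , (s∈ , s≢w) , (t∈ , t≢w)) ◅ ε
  ... | inj₂ s∈v | inj₁ t∈u with refl ← x∈⁅y⁆⇒x≡y v s∈v | refl ← x∈⁅y⁆⇒x≡y u t∈u =
    (~-sym u~v , (s∈ , s≢w) , (t∈ , t≢w)) ◅ ε

  -- Paths outside `H` and their suffixes.

  -- k does not count the final edge, which enters H at a vertex b ≠ a.
  data Path (H : Subset n) (a : Fin n) : Fin n → ℕ → Set where
    last : ∀ {v b} → v ∉ H → v ~ b → b ∈ H → b ≢ a → Path H a v 0
    step : ∀ {v u k} → v ∉ H → v ~ u → Path H a u k → Path H a v (suc k)

  module _ {H : Subset n} {a : Fin n} where

    private
      variable
        k : ℕ

    source∉H : Path H a v k → v ∉ H
    source∉H (last v∉H _ _ _) = v∉H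
    source∉H (step v∉H _ _)   = v∉H

    vertices : Path H a v k → Subset n
    vertices {v = v} (last _ _ _ _) = ⁅ v ⁆
    vertices {v = v} (step _ _ p)   = ⁅ v ⁆ ∪ vertices p

    source∈ : (p : Path H a v k) → v ∈ vertices p
    source∈ (last _ _ _ _) = x∈⁅x⁆ _
    source∈ (step _ _ p)   = x∈p∪q⁺ (inj₁ (x∈⁅x⁆ _))

    vertices∉H : (p : Path H a v k) → x ∈ vertices p → x ∉ H
    vertices∉H (last {v} v∉H _ _ _) x∈ with refl ← x∈⁅y⁆⇒x≡y v x∈ = v∉H
    vertices∉H (step {v} v∉H _ p) x∈ with x∈p∪q⁻ _ _ x∈
    ... | inj₁ x∈v with refl ← x∈⁅y⁆⇒x≡y v x∈v = v∉H
    ... | inj₂ x∈p = vertices∉H p x∈p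

    suffix : (p : Path H a v k) → x ∈ vertices p → ∃[ m ] (m ≤ k × Path H a x m)
    suffix p@(last {v} _ _ _ _) x∈ with refl ← x∈⁅y⁆⇒x≡y v x∈ = _ , ≤-refl , p
    suffix p@(step {v} _ _ q) x∈ with x∈p∪q⁻ _ _ x∈
    ... | inj₁ x∈v with refl ← x∈⁅y⁆⇒x≡y v x∈v = _ , ≤-refl , p
    ... | inj₂ x∈q with m , m≤k , r ← suffix q x∈q = m , m≤n⇒m≤1+n m≤k , r

    properSuffix : (p : Path H a v k) → x ∈ vertices p → x ≢ v → ∃[ m ] (m < k × Path H a x m)
    properSuffix (last {v} _ _ _ _) x∈ x≢v = contradiction (x∈⁅y⁆⇒x≡y v x∈) x≢v
    properSuffix (step {v} _ _ q) x∈ x≢v with x∈p∪q⁻ _ _ x∈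
    ... | inj₁ x∈v = contradiction (x∈⁅y⁆⇒x≡y v x∈v) x≢v
    ... | inj₂ x∈q with m , m≤k , r ← suffix q x∈q = m , s≤s m≤k , r

    -- At most one of `x` and `y` is the second vertex of the path, so the other starts a suffix
    -- that skips at least two vertices.
    properSuffix₂ : (p : Path H a v k) → x ∈ vertices p → y ∈ vertices p → x ≢ v → y ≢ v → x ≢ y →
                    ∃[ m ] (suc m < k × (Path H a x m ⊎ Path H a y m))
    properSuffix₂ (last {v} _ _ _ _) x∈ _ x≢v _ _ = contradiction (x∈⁅y⁆⇒x≡y v x∈) x≢v
    properSuffix₂ {x = x} (step {v} {u} _ _ q) x∈ y∈ x≢v y≢v x≢y
      with x∈p∪q⁻ _ _ x∈ | x∈p∪q⁻ _ _ y∈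
    ... | inj₁ x∈v | _        = contradiction (x∈⁅y⁆⇒x≡y v x∈v) x≢v
    ... | inj₂ _   | inj₁ y∈v = contradiction (x∈⁅y⁆⇒x≡y v y∈v) y≢v
    ... | inj₂ x∈q | inj₂ y∈q with x ≟ u
    ...   | yes refl with m , m<k , r ← properSuffix q y∈q (≢-sym x≢y) = m , s≤s m<k , inj₂ r
    ...   | no x≢u   with m , m<k , r ← properSuffix q x∈q x≢u         = m , s≤s m<k , inj₁ r

    -- Adjoining a shortest path.

    Shortest : Fin n → ℕ → Set
    Shortest v k = ∀ {m} → Path H a v m → k ≤ m

    module _ {K : Subset n} {w : Fin n} (H⊆K : H ⊆ K) where

      Retracts : Fin n → Set
      Retracts u = ∃[ h ] (h ∈ H × h ≢ w × Star (Avoiding G K w) u h)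

      -- Follow `p` to its end. The condition on `b` is met if `w` is `a` or lies outside `H`.
      forward : (p : Path H a v k) → vertices p ⊆ K → w ∉ vertices p →
                (∀ {b} → b ∈ H → b ≢ a → b ≢ w) → u ∈ vertices p → Retracts u
      forward {u = u} (last {v} {b} v∉H v~b b∈H b≢a) p⊆K w∉p avoids u∈
        with refl ← x∈⁅y⁆⇒x≡y v u∈ =
        b , b∈H , avoids b∈H b≢a ,
        (v~b , (p⊆K u∈ , (λ { refl → w∉p u∈ })) , (H⊆K b∈H , avoids b∈H b≢a)) ◅ ε
      forward {u = u} p@(step {v} {v′} v∉H v~v′ q) p⊆K w∉p avoids u∈ with x∈p∪q⁻ _ _ u∈
      ... | inj₂ u∈q = forward q (p⊆K ∘ q⊆p∪q _ _) (w∉p ∘ q⊆p∪q _ _) avoids u∈q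
      ... | inj₁ u∈v
        with refl ← x∈⁅y⁆⇒x≡y v u∈v
        with h , h∈H , h≢w , v′h ← forward q (p⊆K ∘ q⊆p∪q _ _) (w∉p ∘ q⊆p∪q _ _) avoids (source∈ q) =
        h , h∈H , h≢w ,
        (v~v′ , (p⊆K u∈ , (λ { refl → w∉p u∈ })) ,
                (p⊆K v′∈ , (λ { refl → w∉p v′∈ }))) ◅ v′h
        where v′∈ = q⊆p∪q ⁅ v ⁆ _ (source∈ q)

      -- A shortest path visits w at most once, so each vertex u other than w can
      -- be left towards the target if w is before u, and towards v otherwise.
      outward : (p : Path H a v k) → Shortest v k → vertices p ⊆ K → u ∈ vertices p → u ≢ w →
                Retracts u ⊎ (v ≢ w × Star (Avoiding G K w) u v)
      outward (last {v} _ _ _ _) _ _ u∈ u≢w with refl ← x∈⁅y⁆⇒x≡y v u∈ = inj₂ (u≢w , ε)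
      outward (step {v} {v′} v∉H v~v′ q) shortest p⊆K u∈ u≢w with x∈p∪q⁻ _ _ u∈
      ... | inj₁ u∈v with refl ← x∈⁅y⁆⇒x≡y v u∈v = inj₂ (u≢w , ε)
      ... | inj₂ u∈q with outward q (λ r → ℕ.≤-pred (shortest (step v∉H v~v′ r))) (p⊆K ∘ q⊆p∪q _ _)
                                  u∈q u≢w
      ...   | inj₁ retracts = inj₁ retracts
      ...   | inj₂ (v′≢w , uv′) with v ≟ w
      ...     | no v≢w = inj₂ (v≢w , uv′ ◅◅ (edge ◅ ε))
        where
        edge : Avoiding G K w v′ v
        edge = ~-sym v~v′ , (p⊆K (q⊆p∪q ⁅ v ⁆ _ (source∈ q)) , v′≢w) ,
               (p⊆K (p⊆p∪q _ (x∈⁅x⁆ v)) , v≢w)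
      -- The removed vertex is the start `v`. If it recurred on `q`, the suffix from there would be
      -- a shorter path, so `forward` can run along `q`.
      ...     | yes refl =
        inj₁ (forward q (p⊆K ∘ q⊆p∪q _ _) v∉q (λ { b∈H _ refl → v∉H b∈H }) u∈q)
        where
        v∉q : v ∉ vertices q
        v∉q v∈q with m , m≤k , r ← suffix q v∈q = <⇒≱ (s≤s m≤k) (shortest r)

    -- If `w` is `a`, leave along the path to its other end, which is not `a`. Otherwise `outward`
    -- reaches `H` or goes back to `v`, one edge away from `a`.
    robust-∪-path : Robust H → a ∈ H → v ~ a → (p : Path H a v k) → Shortest v k →
                    Robust (H ∪ vertices p)
    robust-∪-path {v = v} robust a∈H v~a p shortest = robust-⊆ H⊆K robust retract
      where
      K = H ∪ vertices p
      H⊆K : H ⊆ K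
      H⊆K = p⊆p∪q _
      p⊆K : vertices p ⊆ K
      p⊆K = q⊆p∪q H _
      retract : ∀ w {u} → u ∈ K → u ≢ w → Retracts {w = w} H⊆K u
      retract w u∈K u≢w with x∈p∪q⁻ H _ u∈K
      ... | inj₁ u∈H = _ , u∈H , u≢w , ε
      ... | inj₂ u∈p with a ≟ w
      ...   | yes refl = forward H⊆K p p⊆K (λ a∈p → vertices∉H p a∈p a∈H) (λ _ b≢a → b≢a) u∈p
      ...   | no a≢w with outward H⊆K p shortest p⊆K u∈p u≢w
      ...     | inj₁ retracts = retracts
      ...     | inj₂ (v≢w , uv) = a , a∈H , a≢w ,
        uv ◅◅ ((v~a , (p⊆K (source∈ p) , v≢w) , (H⊆K a∈H , a≢w)) ◅ ε)

    -- Ears and cores.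

    target : Path H a v k → ∃[ u ] ∃[ b ] (u ∉ H × u ~ b × b ∈ H)
    target (last v∉H v~b b∈H _) = _ , _ , v∉H , v~b , b∈H
    target (step _ _ p)         = target p

    -- Cut the walk at its first vertex in `H`, which differs from `a` because the walk avoids `a`.
    firstHit : ∀ {K h} → Star (Avoiding G K a) v h → v ∉ H → h ∈ H → ∃ (Path H a v)
    firstHit ε v∉H h∈H = contradiction h∈H v∉H
    firstHit (_◅_ {j = u} (v~u , _ , (_ , u≢a)) uh) v∉H h∈H with u ∈? H
    ... | yes u∈H = 0 , last v∉H v~u u∈H u≢a
    ... | no  u∉H with k , p ← firstHit uh u∉H h∈H = suc k , step v∉H v~u p

  path? : ∀ H a v k → Dec (Path H a v k)
  path? H a v zero =
    map′ (λ { (v∉H , _ , v~b , b∈H , b≢a) → last v∉H v~b b∈H b≢a })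
         (λ { (last v∉H v~b b∈H b≢a) → v∉H , _ , v~b , b∈H , b≢a })
         (¬? (v ∈? H) ×-dec any? λ b → (v ~? b) ×-dec (b ∈? H ×-dec ¬? (b ≟ a)))
  path? H a v (suc k) =
    map′ (λ { (v∉H , _ , v~u , p) → step v∉H v~u p })
         (λ { (step v∉H v~u p) → v∉H , _ , v~u , p })
         (¬? (v ∈? H) ×-dec any? λ u → (v ~? u) ×-dec path? H a u k)

  -- An ear of `H` in the sense of ear decompositions, with `k + 1` interior vertices counted with
  -- repetition; only minimality of `k` prevents repetitions.
  Ear : Subset n → ℕ → Set
  Ear H k = ∃[ a ] ∃[ v ] (a ∈ H × v ~ a × Path H a v k)

  ear? : ∀ H k → Dec (Ear H k)
  ear? H k = any? λ a → any? λ v → a ∈? H ×-dec ((v ~? a) ×-dec path? H a v k)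

  -- The edge `h₁~h₂` certifies that `H` contains two distinct vertices of `V`; `r₁~r₂` is the edge
  -- to be deleted in the end.
  record Core (H : Subset n) : Set where
    field
      robust  : Robust H
      {h₁ h₂} : Fin n
      h₁∈H    : h₁ ∈ H
      h₂∈H    : h₂ ∈ H
      h₁~h₂   : h₁ ~ h₂
      {r₁ r₂} : Fin n
      r₁~r₂   : r₁ ~ r₂
      r₁∉H    : r₁ ∉ H
      r₂∉H    : r₂ ∉ H

  extend : ∀ {H K} → Core H → H ⊆ K → Robust K → EdgeOff K → Core K
  extend core H⊆K robust (_ , _ , r₁~r₂ , r₁∉K , r₂∉K) = record
    { robust = robust ; h₁∈H = H⊆K h₁∈H ; h₂∈H = H⊆K h₂∈H ; h₁~h₂ = h₁~h₂
    ; r₁~r₂ = r₁~r₂ ; r₁∉H = r₁∉K ; r₂∉H = r₂∉K }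
    where open Core core using (h₁∈H; h₂∈H; h₁~h₂)

  -- Growing a core.

  module _ (triangleFree : TriangleFree G)
           (another : ∀ {v} → v ∈ V → ∀ x y → ∃[ z ] (v ~ z × z ≢ x × z ≢ y))
           (connectedOff : ∀ {w} → w ∈ V → ConnectedOff G V w) where

    ~⇒≢ : u ~ v → u ≢ v
    ~⇒≢ u~v refl = ~-irrefl u~v

    -- Two-connectedness is used twice: a walk from `v` to `h₁` off `h₂` yields an edge `u~b`
    -- entering `H`, and a walk from `u` off `b` then enters `H` elsewhere.
    ear : ∀ {H} → Core H → v ∈ V → v ∉ H → ∃ (Ear H)
    ear {v = v} {H = H} core v∈V v∉H =
      let _ , p = firstHit (connectedOff h₂∈V v∈V (~⇒∈V h₁~h₂) v≢h₂ (~⇒≢ h₁~h₂)) v∉H h₁∈H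
          u , b , u∉H , u~b , b∈H = target p
          h , h∈H , h∈V , h≢b = other b
          k , q = firstHit (connectedOff (~⇒∈V (~-sym u~b)) (~⇒∈V u~b) h∈V (~⇒≢ u~b) h≢b) u∉H h∈H
      in k , b , u , b∈H , u~b , q
      where
      open Core core
      h₂∈V : h₂ ∈ V
      h₂∈V = ~⇒∈V (~-sym h₁~h₂)
      v≢h₂ : v ≢ h₂
      v≢h₂ refl = v∉H h₂∈H
      other : ∀ b → ∃[ h ] (h ∈ H × h ∈ V × h ≢ b)
      other b with h₁ ≟ b
      ... | yes refl = h₂ , h₂∈H , h₂∈V , ≢-sym (~⇒≢ h₁~h₂)
      ... | no h₁≢b  = h₁ , h₁∈H , ~⇒∈V h₁~h₂ , h₁≢b

    module _ {H : Subset n} (unattached : ∀ {v} → v ∉ H → ¬ Attached H v) where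

      edgeOffEar : ∀ {k a} → (∀ m → Ear H m → k ≤ m) → a ∈ H → v ~ a → (p : Path H a v k) →
                   EdgeOff (H ∪ vertices p)
      -- A single interior vertex would be attached to `H`.
      edgeOffEar least a∈H v~a (last v∉H v~b b∈H b≢a) =
        contradiction (_ , _ , a∈H , b∈H , ≢-sym b≢a , v~a , v~b) (unattached v∉H)
      edgeOffEar {v = v} {k = suc k} {a} least a∈H v~a p@(step {u = u} v∉H v~u q) =
        decidable-stable (edgeOff? (H ∪ vertices p)) impossible
        where
        impossible : ¬ ¬ EdgeOff (H ∪ vertices p)
        -- `z` is a third neighbour of `v`, and `s`, `t` are two neighbours of `z` besides `v`;
        -- every placement of `s` and `t` yields an attached vertex or a shorter ear.
        impossible noEdge
          with z , v~z , z≢a , z≢u ← another (~⇒∈V v~a) a u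
          with s , z~s , s≢v , _   ← another (~⇒∈V (~-sym v~z)) v v
          with t , z~t , t≢v , t≢s ← another (~⇒∈V (~-sym v~z)) v s =
          cases (position z~s s≢v) (position z~t t≢v)
          where
          z∉H : z ∉ H
          z∉H z∈H = unattached v∉H (_ , _ , a∈H , z∈H , ≢-sym z≢a , v~a , v~z)

          z∉p : z ∉ vertices p
          z∉p z∈p with x∈p∪q⁻ _ _ z∈p
          ... | inj₁ z∈v = ~⇒≢ v~z (sym (x∈⁅y⁆⇒x≡y v z∈v))
          ... | inj₂ z∈q with m , m<k , r ← properSuffix q z∈q z≢u =
            <⇒≱ (s≤s m<k) (least _ (_ , _ , a∈H , v~a , step v∉H v~z r))

          z∉K : z ∉ H ∪ vertices p
          z∉K z∈K = [ z∉H , z∉p ]′ (x∈p∪q⁻ H _ z∈K)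

          position : ∀ {s} → z ~ s → s ≢ v → s ∈ H ⊎ s ∈ vertices q
          position {s} z~s s≢v with s ∈? H | s ∈? vertices q
          ... | yes s∈H | _       = inj₁ s∈H
          ... | no _    | yes s∈q = inj₂ s∈q
          ... | no s∉H  | no s∉q  = contradiction (z , s , z~s , z∉K , s∉K) noEdge
            where
            s∉K : s ∉ H ∪ vertices p
            s∉K s∈K with x∈p∪q⁻ H _ s∈K
            ... | inj₁ s∈H = s∉H s∈H
            ... | inj₂ s∈p with x∈p∪q⁻ _ _ s∈p
            ...   | inj₁ s∈v = s≢v (x∈⁅y⁆⇒x≡y v s∈v)
            ...   | inj₂ s∈q = s∉q s∈q

          ≢u : ∀ {s} → z ~ s → s ≢ u
          ≢u z~s refl = triangleFree _ _ _ (v~z , z~s , ~-sym v~u)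

          -- If `s` is `a`, an ear can start at `z` and jump to `t`, skipping `v` and `u`. Otherwise
          -- `v`, `z` are the interior of an ear, while the given one has at least three interior
          -- vertices as `t` lies beyond `u`.
          mixed : ∀ {s t} → z ~ s → s ∈ H → z ~ t → t ∈ vertices q → ⊥
          mixed {s} z~s s∈H z~t t∈q with m , m<k , r ← properSuffix q t∈q (≢u z~t) | s ≟ a
          ... | yes refl = <⇒≱ (s≤s m<k) (least _ (_ , _ , a∈H , z~s , step z∉H z~t r))
          ... | no s≢a   = <⇒≱ (s≤s (≤-trans (s≤s z≤n) m<k))
            (least _ (_ , _ , a∈H , v~a , step v∉H v~z (last z∉H z~s s∈H s≢a)))

          -- The detour adds the vertex `z` and skips at least two.
          shortcut : ∀ {s m} → z ~ s → suc m < k → Path H a s m → ⊥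
          shortcut z~s 1+m<k r =
            <⇒≱ (s≤s 1+m<k) (least _ (_ , _ , a∈H , v~a , step v∉H v~z (step z∉H z~s r)))

          cases : s ∈ H ⊎ s ∈ vertices q → t ∈ H ⊎ t ∈ vertices q → ⊥
          cases (inj₁ s∈H) (inj₁ t∈H) = unattached z∉H (_ , _ , s∈H , t∈H , ≢-sym t≢s , z~s , z~t)
          cases (inj₁ s∈H) (inj₂ t∈q) = mixed z~s s∈H z~t t∈q
          cases (inj₂ s∈q) (inj₁ t∈H) = mixed z~t t∈H z~s s∈q
          cases (inj₂ s∈q) (inj₂ t∈q)
            with properSuffix₂ q s∈q t∈q (≢u z~s) (≢u z~t) (≢-sym t≢s)
          ... | _ , 1+m<k , inj₁ r = shortcut z~s 1+m<k r
          ... | _ , 1+m<k , inj₂ r = shortcut z~t 1+m<k r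

    enlarge : ∀ {H} → (core : Core H) →
              ∀ {r} → r ∈ V → r ∉ H → r ≢ Core.r₁ core → r ≢ Core.r₂ core →
              ∃[ K ] (H ⊂ K × Core K)
    enlarge {H} core {r} r∈V r∉H r≢r₁ r≢r₂
      with any? (λ v → ¬? (v ∈? H) ×-dec (attached? H v ×-dec edgeOff? (H ∪ ⁅ v ⁆)))
    ... | yes (v , v∉H , (a , b , a∈H , b∈H , a≢b , v~a , v~b) , edge) =
      H ∪ ⁅ v ⁆ , (p⊆p∪q _ , v , q⊆p∪q H _ (x∈⁅x⁆ v) , v∉H) ,
      extend core (p⊆p∪q _)
        -- An attached vertex is the interior of an ear of index 0, hence trivially shortest.
        (robust-∪-path robust a∈H v~a (last v∉H v~b b∈H (≢-sym a≢b)) (λ _ → z≤n)) edge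
      where open Core core
    ... | no none = let k , (a , v , a∈H , v~a , p) , least = shortestEar in
      H ∪ vertices p , (p⊆p∪q _ , v , q⊆p∪q H _ (source∈ p) , source∉H p) ,
      extend core (p⊆p∪q _)
        (robust-∪-path robust a∈H v~a p λ r → least _ (_ , _ , a∈H , v~a , r))
        (edgeOffEar unattached least a∈H v~a p)
      where
      open Core core

      shortestEar : ∃ (IsMinimum (Ear H))
      shortestEar = leastWitness (ear? H) (proj₂ (ear core r∈V r∉H))

      -- Otherwise `H ∪ ⁅ v ⁆` would still miss the edge `s~t`, contrary to `none`.
      covers : ∀ {v s t} → v ∉ H → Attached H v → s ~ t → s ∉ H → t ∉ H → v ≢ s → v ≢ t → ⊥
      covers {v} v∉H attached s~t s∉H t∉H v≢s v≢t =
        none (v , v∉H , attached , _ , _ , s~t , off s∉H v≢s , off t∉H v≢t)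
        where
        off : ∀ {s} → s ∉ H → v ≢ s → s ∉ H ∪ ⁅ v ⁆
        off s∉H v≢s s∈ = [ s∉H , v≢s ∘ sym ∘ x∈⁅y⁆⇒x≡y v ]′ (x∈p∪q⁻ H _ s∈)

      unattached : ∀ {v} → v ∉ H → ¬ Attached H v
      unattached {v} v∉H attached with v ≟ r
      ... | yes refl = covers r∉H attached r₁~r₂ r₁∉H r₂∉H r≢r₁ r≢r₂
      -- By `covers` for `v`, the neighbours of `r` other than `v` lie in `H`, so `r` is attached
      -- too, yet `r₁~r₂` misses `r`.
      ... | no v≢r
        with s , r~s , s≢v , _   ← another r∈V v v
        with t , r~t , t≢v , t≢s ← another r∈V v s =
        covers r∉H (s , t , inH r~s s≢v , inH r~t t≢v , ≢-sym t≢s , r~s , r~t) r₁~r₂ r₁∉H r₂∉H r≢r₁ r≢r₂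
        where
        inH : ∀ {s} → r ~ s → s ≢ v → s ∈ H
        inH {s} r~s s≢v = decidable-stable (s ∈? H) λ s∉H →
          covers v∉H attached r~s r∉H s∉H v≢r (≢-sym s≢v)

    -- The maximal core and the deleted edge.

    Cofinal : ∀ {H} → Core H → Set
    Cofinal {H} core = ∀ {r} → r ∈ V → r ≢ r₁ → r ≢ r₂ → r ∈ H
      where open Core core using (r₁; r₂)

    maximalCore : ∀ {H} → Core H → ∃[ K ] ∃ (Cofinal {K})
    maximalCore {H} core = go core (⊃-wellFounded H)
      where
      go : ∀ {H} → Core H → Acc _⊃_ H → ∃[ K ] ∃ (Cofinal {K})
      go {H} core (acc rs)
        with any? (λ r → r ∈? V ×-dec (¬? (r ∈? H) ×-dec
                         (¬? (r ≟ Core.r₁ core) ×-dec ¬? (r ≟ Core.r₂ core))))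
      ... | no none = H , core , λ {r} r∈V r≢r₁ r≢r₂ →
        decidable-stable (r ∈? H) λ r∉H → none (r , r∈V , r∉H , r≢r₁ , r≢r₂)
      ... | yes (r , r∈V , r∉H , r≢r₁ , r≢r₂) with K , H⊂K , core′ ← enlarge core r∈V r∉H r≢r₁ r≢r₂ =
        go core′ (rs H⊂K)

    -- The degree bound gives a path `h₂`, `h₁`, `x`, `y` on distinct vertices; its first edge spans
    -- `H` and its last edge avoids `H`.
    initialCore : v ∈ V → ∃ Core
    initialCore {v = h₁} h₁∈V
      with h₂ , h₁~h₂ , _            ← another h₁∈V h₁ h₁
      with x , h₁~x , x≢h₂ , _       ← another h₁∈V h₂ h₂
      with y , x~y , y≢h₁ , y≢h₂     ← another (~⇒∈V (~-sym h₁~x)) h₁ h₂ =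
      ⁅ h₁ ⁆ ∪ ⁅ h₂ ⁆ , record
        { robust = robust-edge h₁~h₂
        ; h₁∈H   = x∈p∪q⁺ (inj₁ (x∈⁅x⁆ h₁))
        ; h₂∈H   = x∈p∪q⁺ (inj₂ (x∈⁅x⁆ h₂))
        ; h₁~h₂  = h₁~h₂
        ; r₁~r₂  = x~y
        ; r₁∉H   = off (≢-sym (~⇒≢ h₁~x)) x≢h₂
        ; r₂∉H   = off y≢h₁ y≢h₂
        }
      where
      off : ∀ {s} → s ≢ h₁ → s ≢ h₂ → s ∉ ⁅ h₁ ⁆ ∪ ⁅ h₂ ⁆
      off s≢h₁ s≢h₂ s∈ = [ s≢h₁ ∘ x∈⁅y⁆⇒x≡y h₁ , s≢h₂ ∘ x∈⁅y⁆⇒x≡y h₂ ]′ (x∈p∪q⁻ _ _ s∈)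

    -- A neighbour `s` of `x` serves unless it is `v`; then a neighbour `t` of `y` serves, as
    -- `t = v` would close a triangle with `x` and `y`.
    third : x ~ y → ∀ u v → ∃[ w ] (w ∈ V × (w ≢ x × w ≢ y) × w ≢ u × w ≢ v)
    third {x = x} {y = y} x~y u v
      with s , x~s , s≢y , s≢u ← another (~⇒∈V x~y) y u | s ≟ v
    ... | no s≢v = s , ~⇒∈V (~-sym x~s) , (≢-sym (~⇒≢ x~s) , s≢y) , s≢u , s≢v
    ... | yes refl with t , y~t , t≢x , t≢u ← another (~⇒∈V (~-sym x~y)) x u =
      t , ~⇒∈V (~-sym y~t) , (t≢x , ≢-sym (~⇒≢ y~t)) , t≢u ,
      λ { refl → triangleFree _ _ _ (x~y , y~t , ~-sym x~s) }

    -- `V′` consists of the vertices of `V` in `H`, and edges of `G` have both ends in `V`, so the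
    -- walks given by robustness of `H` stay in `V′`.
    cofinal⇒κ≥2 : ∀ {H} (core : Core H) → Cofinal core →
                  κ[ G - (⁅ Core.r₁ core ⁆ ∪ ⁅ Core.r₂ core ⁆) ]≥ 2
    cofinal⇒κ≥2 {H} core cofinal = κ≥2-intro G′ r₁ third′ connectedOff′
      where
      open Core core
      G′ = G - (⁅ r₁ ⁆ ∪ ⁅ r₂ ⁆)
      V′ = Graph.V G′

      V′⊆H : V′ ⊆ H
      V′⊆H r∈ = cofinal (x∈p─q⇒x∈p r∈)
        (λ { refl → x∈p─q⇒x∉q r∈ (p⊆p∪q _ (x∈⁅x⁆ r₁)) })
        (λ { refl → x∈p─q⇒x∉q r∈ (q⊆p∪q ⁅ r₁ ⁆ _ (x∈⁅x⁆ r₂)) })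

      ∈V′ : ∀ {r} → r ∈ V → r ≢ r₁ → r ≢ r₂ → r ∈ V′
      ∈V′ r∈V r≢r₁ r≢r₂ = x∈p∧x∉q⇒x∈p─q r∈V λ r∈ →
        [ r≢r₁ ∘ x∈⁅y⁆⇒x≡y r₁ , r≢r₂ ∘ x∈⁅y⁆⇒x≡y r₂ ]′ (x∈p∪q⁻ _ _ r∈)

      third′ : ∀ u v → ∃[ w ] (w ∈ V′ × w ≢ u × w ≢ v)
      third′ u v with w , w∈V , (w≢r₁ , w≢r₂) , w≢u , w≢v ← third r₁~r₂ u v =
        w , ∈V′ w∈V w≢r₁ w≢r₂ , w≢u , w≢v

      connectedOff′ : ∀ {w} → w ∈ V′ → ConnectedOff G′ V′ w
      connectedOff′ {w} _ u∈ v∈ u≢w v≢w =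
        Star.map restrict (robust w (V′⊆H u∈) (V′⊆H v∈) u≢w v≢w)
        where
        H∩V⊆V′ : ∀ {r} → r ∈ V → r ∈ H → r ∈ V′
        H∩V⊆V′ r∈V r∈H = ∈V′ r∈V (λ { refl → r₁∉H r∈H }) (λ { refl → r₂∉H r∈H })

        restrict : ∀ {a b} → Avoiding G H w a b → Avoiding G′ V′ w a b
        restrict (a~b , (a∈H , a≢w) , (b∈H , b≢w)) = ((a∈ , b∈) , a~b) , (a∈ , a≢w) , (b∈ , b≢w)
          where
          a∈ = H∩V⊆V′ (~⇒∈V a~b) a∈H
          b∈ = H∩V⊆V′ (~⇒∈V (~-sym a~b)) b∈H

    ∃-edge-κ≥2 : v ∈ V → ∃[ x ] ∃[ y ] (x ~ y × κ[ G - (⁅ x ⁆ ∪ ⁅ y ⁆) ]≥ 2)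
    ∃-edge-κ≥2 v∈V with _ , core , cofinal ← maximalCore (proj₂ (initialCore v∈V)) =
      _ , _ , Core.r₁~r₂ core , cofinal⇒κ≥2 core cofinal

proposition1p1 : ∀ {n : ℕ} (G : Graph n) → 2 -Connected G → TriangleFree G → δ[ G ]≥ 3 →
    ∃[ x ] ∃[ y ] (Graph._~_ G x y × κ[ G - (⁅ x ⁆ ∪ ⁅ y ⁆) ]≥ 2)
proposition1p1 G κ≥2 triangleFree δ≥3@(_ , ((_ , v∈V , _) , _) , _) =
  ∃-edge-κ≥2 G triangleFree (δ≥3⇒another G δ≥3) (κ≥2⇒connectedOff G κ≥2) v∈V
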